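{- Let $C$ be an at most countable set and let $W\subseteq C^\omega$ be a prefix-independent objective which is positional over finite arenas and admits a weakly neutral letter. Then there exists a prefix-independent objective $W'\subseteq W$ such that $W'\equiv W$ (i.e. $W'$ and $W$ are finitely equivalent) and $W'$ is positional over arbitrary arenas.
   Context: **Graphs.** A $C$-graph $G$ is a (possibly infinite) set of vertices $V(G)$ with a set of edges $E(G)\subseteq V(G)\times C\times V(G)$; an edge $(v,c,v')$ is written $v\xrightarrow{c}v'$ and has label $c$. Every vertex is assumed to have at least one outgoing edge. $G$ is finite if both $V(G)$ and $E(G)$ are finite. A path is a sequence of edges with matching endpoints $v_0\xrightarrow{c_0}v_1\xrightarrow{c_1}\cdots$; its label is $c_0c_1\cdots$. $\mathrm{L}(G)\subseteq C^\omega$ is the set of labels of all infinite paths in $G$ (from any vertex). A morphism $G\to G'$ is a map $\phi\colon V(G)\to V(G')$ such that $v\xrightarrow{c}v'\in E(G)$ implies $\phi(v)\xrightarrow{c}\phi(v')\in E(G')$. **Games.** An objective is a set $W\subseteq C^\omega$; it is prefix-independent if for all $c\in C$ and $w\in C^\omega$, $cw\in W\iff w\in W$. A graph $G$ satisfies $W$ if $\mathrm{L}(G)\subseteq W$. A $C$-arena $A$ is a $C$-graph with a partition $V(A)=V_{\mathrm{Eve}}\sqcup V_{\mathrm{Adam}}$. A strategy (for Eve) in $A$ is a pair $(S,\pi)$ with $S$ a $C$-graph and $\pi\colon S\to A$ a surjective (on vertices) morphism such that for every $v\in V_{\mathrm{Adam}}$, every edge $v\xrightarrow{c}v'\in E(A)$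 and every $s\in\pi^{ -1}(v)$, there is an edge $s\xrightarrow{c}s'\in E(S)$ with $\pi(s')=v'$. The strategy is positional if $\pi$ is injective. Eve wins the game $(A,W)$ with $(S,\pi)$ if $S$ satisfies $W$; she wins $(A,W)$ if some such strategy exists. $W$ is positional over arbitrary (resp. finite) arenas if for every (resp. every finite) $C$-arena $A$, whenever Eve wins $(A,W)$, she wins $(A,W)$ with a positional strategy. Two prefix-independent objectives $W,W'\subseteq C^\omega$ are finitely equivalent, written $W\equiv W'$, if for all finite $C$-arenas $A$, Eve wins $(A,W)$ if and only if Eve wins $(A,W')$. **Neutral letters.** $\varepsilon\in C$ is weakly neutral for $W$ if for every $w\in C^\omega$ and every decomposition $w=w_0w_1w_2\cdots$ into finite non-empty words $w_i\in C^+$, one has $w\in W\iff \varepsilon w_0\varepsilon w_1\varepsilon w_2\cdots\in W$. -}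

module Defs where

open import Data.List.Base using (List; []; _∷_)
open import Data.List.Membership.Propositional using (_∈_)
open import Data.List.NonEmpty.Base using (List⁺; _∷⁺_) renaming (_∷_ to _∷′_)
open import Data.Nat.Base using (ℕ; zero; suc)
open import Data.Product.Base using (Σ; ∃; ∃₂; _×_; _,_)
open import Function.Base using (_∘_)
open import Function.Bundles using (_⇔_)
open import Function.Definitions using (Injective; Surjective)
open import Level using (Level) renaming (suc to lsuc)
open import Relation.Binary.PropositionalEquality.Core using (_≡_; _≗_)
open import Relation.Unary using (Pred)

private
  variable
    ℓ : Level
    C : Set ℓ

Word : Set ℓ → Set ℓ
Word C = ℕ → C

infixr 5 _◂_

_◂_ : C → Word C → Word C
(c ◂ w) zero    = c
(c ◂ w) (suc n) = w n

-- The infinite concatenation u₀ u₁ u₂ ⋯ of non-empty finite words;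
-- concat-from c cs u is the infinite word c cs u₀ u₁ u₂ ⋯.

concat-from : C → List C → (ℕ → List⁺ C) → Word C
concat-from c cs       u zero    = c
concat-from c (d ∷ ds) u (suc n) = concat-from d ds u n
concat-from c []       u (suc n) with u 0
... | d ∷′ ds = concat-from d ds (u ∘ suc) n

concatω : (ℕ → List⁺ C) → Word C
concatω u with u 0
... | c ∷′ cs = concat-from c cs (u ∘ suc)

-- A subset of C^ω. Infinite words are functions and function extensionality
-- is not assumed, so membership is required to respect pointwise equality.

record Objective (C : Set ℓ) : Set (lsuc ℓ) where
  field
    Member : Pred (Word C) ℓ
    resp   : ∀ {w w′} → w ≗ w′ → Member w → Member w′

infix 4 _∈ᵂ_ _⊆ᵂ_

_∈ᵂ_ : {C : Set ℓ} → Word C → Objective C → Set ℓ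
w ∈ᵂ W = Objective.Member W w

_⊆ᵂ_ : {C : Set ℓ} → Objective C → Objective C → Set ℓ
W ⊆ᵂ W′ = ∀ w → w ∈ᵂ W → w ∈ᵂ W′

PrefixIndependent : {C : Set ℓ} → Objective C → Set ℓ
PrefixIndependent W = ∀ c w → (c ◂ w) ∈ᵂ W ⇔ w ∈ᵂ W

WeaklyNeutral : {C : Set ℓ} → Objective C → C → Set ℓ
WeaklyNeutral {C = C} W ε =
  ∀ (w : Word C) (u : ℕ → List⁺ C) → w ≗ concatω u →
  w ∈ᵂ W ⇔ concatω (λ i → ε ∷⁺ u i) ∈ᵂ W

-- Edge v c v′ is the proposition that (v , c , v′) is an edge; which proof
-- witnesses it is never used, so E(G) is the subset of V × C × V it describes.

record Graph (C : Set ℓ) : Set (lsuc ℓ) where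
  field
    Vertex : Set ℓ
    Edge   : Vertex → C → Vertex → Set ℓ
    total  : ∀ v → ∃₂ λ c v′ → Edge v c v′

open Graph

FiniteGraph : {C : Set ℓ} → Graph C → Set ℓ
FiniteGraph {C = C} G =
  (∃ λ (vs : List (Vertex G)) → ∀ v → v ∈ vs) ×
  (∃ λ (es : List (Vertex G × C × Vertex G)) →
     ∀ v c v′ → Edge G v c v′ → (v , c , v′) ∈ es)

L : {C : Set ℓ} → Graph C → Pred (Word C) ℓ
L G w = ∃ λ (ρ : ℕ → Vertex G) → ∀ i → Edge G (ρ i) (w i) (ρ (suc i))

_Satisfies_ : {C : Set ℓ} → Graph C → Objective C → Set ℓ
G Satisfies W = ∀ w → L G w → w ∈ᵂ W

record Morphism {C : Set ℓ} (G G′ : Graph C) : Set ℓ where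
  field
    map      : Vertex G → Vertex G′
    map-edge : ∀ {v c v′} → Edge G v c v′ → Edge G′ (map v) c (map v′)

data Player : Set where
  eve adam : Player

record Arena (C : Set ℓ) : Set (lsuc ℓ) where
  field
    graph : Graph C
    owner : Vertex graph → Player

open Arena

FiniteArena : {C : Set ℓ} → Arena C → Set ℓ
FiniteArena A = FiniteGraph (graph A)

record Strategy {C : Set ℓ} (A : Arena C) : Set (lsuc ℓ) where
  field
    S : Graph C
    π : Morphism S (graph A)

  open Morphism π public

  field
    surjective  : Surjective _≡_ _≡_ map
    adam-closed : ∀ {v c v′} → owner A v ≡ adam → Edge (graph A) v c v′ →
                  ∀ s → map s ≡ v → ∃ λ s′ → Edge S s c s′ × map s′ ≡ v′

Positional : {C : Set ℓ} {A : Arena C} → Strategy A → Set ℓ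
Positional σ = Injective _≡_ _≡_ (Strategy.map σ)

_WinsWith_ : {C : Set ℓ} {A : Arena C} → Objective C → Strategy A → Set ℓ
W WinsWith σ = Strategy.S σ Satisfies W

EveWins : {C : Set ℓ} → Arena C → Objective C → Set (lsuc ℓ)
EveWins A W = Σ (Strategy A) λ σ → W WinsWith σ

EveWinsPositionally : {C : Set ℓ} → Arena C → Objective C → Set (lsuc ℓ)
EveWinsPositionally A W = Σ (Strategy A) λ σ → Positional σ × W WinsWith σ

PositionalOverArbitraryArenas : {C : Set ℓ} → Objective C → Set (lsuc ℓ)
PositionalOverArbitraryArenas {C = C} W =
  (A : Arena C) → EveWins A W → EveWinsPositionally A W

PositionalOverFiniteArenas : {C : Set ℓ} → Objective C → Set (lsuc ℓ)
PositionalOverFiniteArenas {C = C} W =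
  (A : Arena C) → FiniteArena A → EveWins A W → EveWinsPositionally A W

FinitelyEquivalent : {C : Set ℓ} → Objective C → Objective C → Set (lsuc ℓ)
FinitelyEquivalent {C = C} W W′ =
  (A : Arena C) → FiniteArena A → EveWins A W ⇔ EveWins A W′

{-# OPTIONS --safe #-}
module Submission where

-- W′ (MonotoneCore W below) consists of the words having a suffix that labels a path of some finite,
-- linearly ordered, monotone graph (u ≥ v →c v′ ≥ u′ implies u →c u′) whose labels
-- all belong to W.
--
-- Finite arenas: Eve may win W by a finite graph G. Give her a choice, after each
-- move of Adam, among the vertices of a set X containing the target. She still wins,
-- the extra ε-moves being neutral, hence wins positionally, and her fixed choice
-- x ∈ X may be added as a target next to any other target in X. Iterating with X ∖ {x}
-- orders G, and closing under the order yields a monotone graph, still satisfying W.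
--
-- Arbitrary arenas: as C is countable there are countably many finite monotone graphs,
-- so a Baire category argument in a graph satisfying W′ finds a vertex all of whose
-- paths are read by a single one of them. Removing such vertices transfinitely ranks
-- every vertex by an ordinal, a monotone graph and a state of it. Following, in each
-- fibre of Eve's strategy, an element of lexicographically least rank is positional, and
-- along its paths the ordinal and the monotone graph eventually stabilise.

open import Defs
open import Axiom.ExcludedMiddle using (ExcludedMiddle)
open import Data.Empty using (⊥; ⊥-elim)
open import Data.List.Base using (List; []; _∷_; _++_; map; filter; length; cartesianProduct)
open import Data.List.Membership.Propositional using (_∈_)
open import Data.List.Membership.Propositional.Properties
open import Data.List.NonEmpty.Base using (List⁺) renaming (_∷_ to _∷′_)
open import Data.List.Properties using (∷-injective; filter-notAll)
open import Data.List.Relation.Unary.Any as Any using (here; there)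
open import Data.Maybe.Base using (Maybe; just; nothing)
open import Data.Nat.Base using (ℕ; zero; suc; _+_; _*_; _∸_; _⊔_; _≤_; _<_; z≤n; s≤s; s≤s⁻¹)
open import Data.Nat.Binary.Base using (ℕᵇ; 2[1+_]; 1+[2_]; toℕ) renaming (zero to zeroᵇ)
open import Data.Nat.Binary.Properties using (toℕ-injective; 2[1+_]-injective; 1+[2_]-injective)
open import Data.Nat.Induction using (<-wellFounded)
open import Data.Nat.Properties
open import Data.Product.Base using (∃; ∃₂; _×_; _,_; proj₁; proj₂)
open import Data.Sum.Base using (_⊎_; inj₁; inj₂)
open import Data.Unit.Polymorphic.Base using (⊤)
open import Function.Base using (_∘_; id; const)
open import Function.Bundles using (_↣_; _⇔_; mk⇔; Injection; Equivalence)
open import Induction.WellFounded using (WellFounded; Acc; acc)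
open import Level using (Level; Lift) renaming (suc to lsuc)
open import Relation.Binary.Core using (Rel)
open import Relation.Binary.Definitions using (Transitive)
open import Relation.Binary.PropositionalEquality using (_≡_; _≢_; _≗_; refl; sym; trans; cong; subst)
open import Relation.Nullary using (¬_; Dec; yes; no)
open import Relation.Nullary.Decidable using (decidable-stable)
open import Relation.Unary using (Pred; _⊆_)

open Graph
open Arena

-- Ordinals

-- `sup f` stands for the least ordinal strictly above every `f i`. Several trees denote the same
-- ordinal, so equality of ordinals is `≤ᵒ` in both directions.
data Ord (ℓ : Level) : Set (lsuc ℓ) where
  sup : {I : Set ℓ} → (I → Ord ℓ) → Ord ℓ

infix 4 _≤ᵒ_ _<ᵒ_

_≤ᵒ_ : ∀ {ℓ} → Rel (Ord ℓ) ℓ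
sup f ≤ᵒ sup g = ∀ i → ∃ λ j → f i ≤ᵒ g j

_<ᵒ_ : ∀ {ℓ} → Rel (Ord ℓ) ℓ
α <ᵒ sup g = ∃ λ j → α ≤ᵒ g j

≤ᵒ-refl : ∀ {ℓ} (α : Ord ℓ) → α ≤ᵒ α
≤ᵒ-refl (sup f) i = i , ≤ᵒ-refl (f i)

≤ᵒ-trans : ∀ {ℓ} → Transitive (_≤ᵒ_ {ℓ})
≤ᵒ-trans {i = sup f} {sup g} {sup h} f≤g g≤h i with f≤g i
... | j , fi≤gj with g≤h j
... | k , gj≤hk = k , ≤ᵒ-trans fi≤gj gj≤hk

<ᵒ⇒≤ᵒ : ∀ {ℓ} (α β : Ord ℓ) → α <ᵒ β → α ≤ᵒ β
<ᵒ⇒≤ᵒ (sup f) (sup g) (j , α≤gj) i = j , <ᵒ⇒≤ᵒ (f i) (g j) (<≤ (g j) α≤gj)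
  where
  <≤ : ∀ β → sup f ≤ᵒ β → f i <ᵒ β
  <≤ (sup h) f≤h = f≤h i

<ᵒ-wellFounded : ∀ {ℓ} → WellFounded (_<ᵒ_ {ℓ})
<ᵒ-wellFounded α = below α α (≤ᵒ-refl α)
  where
  -- Predecessors need not be subtrees; each is dominated by a branch of `α`, so the recursion runs
  -- on that bound.
  below : ∀ α β → β ≤ᵒ α → Acc _<ᵒ_ β
  below (sup g) (sup f) f≤g = acc λ {γ} (i , γ≤fi) →
    let j , fi≤gj = f≤g i in below (g j) γ (≤ᵒ-trans γ≤fi fi≤gj)

<ᵒ-irrefl : ∀ {ℓ} (α : Ord ℓ) → ¬ (α <ᵒ α)
<ᵒ-irrefl (sup f) (i , f≤fi) = <ᵒ-irrefl (f i) (at-i (f i) f≤fi)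
  where
  at-i : ∀ β → sup f ≤ᵒ β → f i <ᵒ β
  at-i (sup h) f≤h = f≤h i

≤ᵒ⇒≯ᵒ : ∀ {ℓ} (α β : Ord ℓ) → α ≤ᵒ β → ¬ (β <ᵒ α)
≤ᵒ⇒≯ᵒ (sup f) β f≤β (i , β≤fi) = <ᵒ-irrefl (sup f) (i , ≤ᵒ-trans f≤β β≤fi)

-- Interleaving

interleave : ∀ {a} {A : Set a} → (ℕ → A) → (ℕ → A) → ℕ → A
interleave f g zero          = f zero
interleave f g (suc zero)    = g zero
interleave f g (suc (suc n)) = interleave (f ∘ suc) (g ∘ suc) n

interleave-step : ∀ {a b r} {A : Set a} {B : Set b} (R : A → B → A → Set r)
  (ρ ρ′ : ℕ → A) (w w′ : ℕ → B) →
  (∀ k → R (ρ k) (w k) (ρ′ k)) → (∀ k → R (ρ′ k) (w′ k) (ρ (suc k))) →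
  ∀ n → R (interleave ρ ρ′ n) (interleave w w′ n) (interleave ρ ρ′ (suc n))
interleave-step R ρ ρ′ w w′ h h′ zero          = h 0
interleave-step R ρ ρ′ w w′ h h′ (suc zero)    = h′ 0
interleave-step R ρ ρ′ w w′ h h′ (suc (suc n)) =
  interleave-step R (ρ ∘ suc) (ρ′ ∘ suc) (w ∘ suc) (w′ ∘ suc) (h ∘ suc) (h′ ∘ suc) n

interleave-even-odd : ∀ {a} {A : Set a} (w : ℕ → A) (c : A) →
  (∀ k → w (suc (k * 2)) ≡ c) → interleave (λ k → w (k * 2)) (const c) ≗ w
interleave-even-odd w c odd zero          = refl
interleave-even-odd w c odd (suc zero)    = sym (odd 0)
interleave-even-odd w c odd (suc (suc n)) =
  interleave-even-odd (w ∘ suc ∘ suc) c (odd ∘ suc) n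

module _ {ℓ} {C : Set ℓ} (W : Objective C) where

  open Objective W using (resp)

  drop-∈ : PrefixIndependent W → ∀ n w → (λ k → w (k + n)) ∈ᵂ W → w ∈ᵂ W
  drop-∈ prefix n w = go n w ∘ resp (λ k → cong w (+-comm k n))
    where
    go : ∀ n w → (λ k → w (n + k)) ∈ᵂ W → w ∈ᵂ W
    go zero    w w∈ = w∈
    go (suc n) w w∈ = resp (λ { zero → refl ; (suc _) → refl })
      (Equivalence.from (prefix (w 0) (w ∘ suc)) (go n (w ∘ suc) w∈))

  -- Weak neutrality for the cut into single letters gives the word with an `ε` before each letter;
  -- prefix-independence removes the first `ε`.
  interleave-neutral : PrefixIndependent W → ∀ {ε} → WeaklyNeutral W ε →
    ∀ w → w ∈ᵂ W ⇔ interleave w (const ε) ∈ᵂ W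
  interleave-neutral prefix {ε} neutral w = mk⇔
    (λ w∈ → Equivalence.to (prefix ε _) (resp (with-ε w) (Equivalence.to eq w∈)))
    (λ w∈ → Equivalence.from eq (resp (λ n → sym (with-ε w n)) (Equivalence.from (prefix ε _) w∈)))
    where
    singletons : Word C → ℕ → List⁺ C
    singletons w i = w i ∷′ []

    without-ε : ∀ w → w ≗ concatω (singletons w)
    without-ε w zero    = refl
    without-ε w (suc n) = go (w 0) (w ∘ suc) n
      where
      go : ∀ c w n → w n ≡ concat-from c [] (singletons w) (suc n)
      go c w zero    = refl
      go c w (suc n) = go (w 0) (w ∘ suc) n

    with-ε : ∀ w → concatω (λ i → ε ∷′ w i ∷ []) ≗ (ε ◂ interleave w (const ε))
    with-ε w zero          = refl
    with-ε w (suc n) = go w n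
      where
      go : ∀ w → (concatω (λ i → ε ∷′ w i ∷ []) ∘ suc) ≗ interleave w (const ε)
      go w zero = refl
      go w (suc zero) = refl
      go w (suc (suc n)) = go (w ∘ suc) n

    eq = neutral w (singletons w) (without-ε w)

-- Injective codes of lists

-- In bijective base 2, least significant digit first, an entry `n` becomes `n` digits 2 closed by a
-- digit 1.
encode : List ℕ → ℕᵇ
encode []           = zeroᵇ
encode (zero ∷ xs)  = 1+[2 encode xs ]
encode (suc n ∷ xs) = 2[1+ encode (n ∷ xs) ]

encode-injective : ∀ xs ys → encode xs ≡ encode ys → xs ≡ ys
encode-injective []           []           eq = refl
encode-injective []           (zero ∷ ys)  ()
encode-injective []           (suc n ∷ ys) ()
encode-injective (zero ∷ xs)  []           ()
encode-injective (suc m ∷ xs) []           ()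
encode-injective (zero ∷ xs)  (suc n ∷ ys) ()
encode-injective (suc m ∷ xs) (zero ∷ ys)  ()
encode-injective (zero ∷ xs)  (zero ∷ ys)  eq =
  cong (0 ∷_) (encode-injective xs ys (1+[2_]-injective eq))
encode-injective (suc m ∷ xs) (suc n ∷ ys) eq
  with refl , refl ← ∷-injective (encode-injective (m ∷ xs) (n ∷ ys) (2[1+_]-injective eq)) = refl

head<encode : ∀ n xs → n < toℕ (encode (n ∷ xs))
head<encode zero    xs = s≤s z≤n
head<encode (suc n) xs = s≤s (≤-trans (head<encode n xs) (m≤m+n _ _))

-- Finite monotone graphs

-- A list of edges stands for the graph on ℕ whose edges are obtained from the
-- listed ones by raising the source and lowering the target.

EdgeList : ∀ {ℓ} → Set ℓ → Set ℓ
EdgeList C = List (ℕ × C × ℕ)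

module _ {ℓ} {C : Set ℓ} where

  Step : EdgeList C → ℕ → C → ℕ → Set ℓ
  Step es q c q′ = ∃₂ λ p p′ → (p , c , p′) ∈ es × p ≤ q × q′ ≤ p′

  Step-mono : ∀ {es p q c p′ q′} → p ≤ q → q′ ≤ p′ → Step es p c p′ → Step es q c q′
  Step-mono p≤q q′≤p′ (r , r′ , e∈ , r≤p , p′≤r′) =
    r , r′ , e∈ , ≤-trans r≤p p≤q , ≤-trans q′≤p′ p′≤r′

  Run : EdgeList C → Word C → (ℕ → ℕ) → Set ℓ
  Run es w ρ = ∀ k → Step es (ρ k) (w k) (ρ (suc k))

  target-bound : EdgeList C → ℕ
  target-bound []                 = 0
  target-bound ((_ , _ , p) ∷ es) = p ⊔ target-bound es

  -- Targets are only ever lowered, so a run is bounded from its second state on. The states range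
  -- over all of ℕ, yet greedy reading has a maximum to choose.
  Step-bound : ∀ es {q c q′} → Step es q c q′ → q′ ≤ target-bound es
  Step-bound es (_ , _ , e∈ , _ , q′≤p′) = ≤-trans q′≤p′ (bound es e∈)
    where
    bound : ∀ es {p c p′} → (p , c , p′) ∈ es → p′ ≤ target-bound es
    bound (_ ∷ es) (here refl) = m≤m⊔n _ _
    bound (_ ∷ es) (there e∈)  = m≤n⇒m≤o⊔n _ (bound es e∈)

  module _ (W : Objective C) where

    Sound : EdgeList C → Set ℓ
    Sound es = ∀ w ρ → Run es w ρ → w ∈ᵂ W

    MonotoneCore : Objective C
    MonotoneCore = record
      { Member = λ w → ∃ λ es → Sound es × ∃₂ λ n ρ → Run es (λ k → w (k + n)) ρ
      ; resp   = λ { w≗w′ (es , sound , n , ρ , run) → es , sound , n , ρ ,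
                     λ k → subst (λ c → Step es (ρ k) c (ρ (suc k))) (w≗w′ (k + n)) (run k) }
      }

    MonotoneCore-prefixIndependent : PrefixIndependent MonotoneCore
    MonotoneCore-prefixIndependent c w = mk⇔
      (λ { (es , sound , n , ρ , run) → es , sound , n , ρ ∘ suc , run ∘ suc })
      (λ { (es , sound , n , ρ , run) → es , sound , suc n , ρ ,
           λ k → subst (λ d → Step es (ρ k) d (ρ (suc k))) (sym (cong (c ◂ w) (+-suc k n))) (run k) })

    MonotoneCore-⊆ : PrefixIndependent W → MonotoneCore ⊆ᵂ W
    MonotoneCore-⊆ prefix w (es , sound , n , ρ , run) = drop-∈ W prefix n w (sound _ ρ run)

-- Ranking a graph that satisfies the monotone core

-- Bad X es v q: some path from v outside X has a label that es cannot read from q.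
-- Reading greedily, the best state after a letter is the largest target.

data Bad {ℓ} {C : Set ℓ} (G : Graph C) (X : Pred (Vertex G) ℓ) (es : EdgeList C)
    : Vertex G → ℕ → Set ℓ where
  stuck : ∀ {v q c v′} → Edge G v c v′ → ¬ X v′ →
          (∀ q′ → ¬ Step es q c q′) → Bad G X es v q
  step  : ∀ {v q c v′ q′} → Edge G v c v′ → ¬ X v′ →
          (∀ q″ → Step es q c q″ → q″ ≤ q′) → Bad G X es v′ q′ → Bad G X es v q

module _ {ℓ} {C : Set ℓ} (W : Objective C) (G : Graph C) where

  Bad-antitone : ∀ {X Y es v q} → X ⊆ Y → Bad G Y es v q → Bad G X es v q
  Bad-antitone X⊆Y (stuck e v∉Y none)    = stuck e (v∉Y ∘ X⊆Y) none
  Bad-antitone X⊆Y (step e v∉Y greedy b) = step e (v∉Y ∘ X⊆Y) greedy (Bad-antitone X⊆Y b)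

  Readable : Pred (Vertex G) ℓ → Pred (Vertex G) ℓ
  Readable X v = ∃ λ es → Sound W es × ∃ λ q → ¬ Bad G X es v q

  -- The transfinite removal, akin to Cantor-Bendixson derivatives: `Below α` holds the vertices
  -- that become readable at some stage before `α`, where stage `β` ignores edges into `Below β`.
  Below : Ord ℓ → Pred (Vertex G) ℓ
  Below (sup f) v = ∃ λ i → Readable (Below (f i)) v

  Below-mono : ∀ α β → α ≤ᵒ β → Below α ⊆ Below β
  Below-mono (sup f) (sup g) f≤g (i , es , sound , q , ¬bad) =
    let j , fi≤gj = f≤g i in
    j , es , sound , q , λ bad → ¬bad (Bad-antitone (Below-mono (f i) (g j) fi≤gj) bad)

-- Coding edge lists

module _ {ℓ} {C : Set ℓ} (C↣ℕ : C ↣ ℕ) where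

  open Injection C↣ℕ using (to; injective)

  flatten : EdgeList C → List ℕ
  flatten []                  = []
  flatten ((p , c , q) ∷ es)  = p ∷ to c ∷ q ∷ flatten es

  flatten-injective : ∀ es es′ → flatten es ≡ flatten es′ → es ≡ es′
  flatten-injective []       []         eq = refl
  flatten-injective ((p , c , q) ∷ es) ((p′ , c′ , q′) ∷ es′) eq
    with refl , eq₁ ← ∷-injective eq
    with c≡c′ , eq₂ ← ∷-injective eq₁
    with refl , eq₃ ← ∷-injective eq₂
    with refl ← injective c≡c′
    with refl ← flatten-injective es es′ eq₃ = refl

  code : EdgeList C → ℕ
  code es = toℕ (encode (flatten es))

  code-injective : ∀ es es′ → code es ≡ code es′ → es ≡ es′
  code-injective es es′ eq =
    flatten-injective es es′ (encode-injective _ _ (toℕ-injective eq))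

  pair-code : ℕ → EdgeList C → ℕ
  pair-code q es = toℕ (encode (q ∷ flatten es))

  pair-code-injective : ∀ q q′ es es′ → pair-code q es ≡ pair-code q′ es′ → q ≡ q′ × es ≡ es′
  pair-code-injective q q′ es es′ eq
    with refl , eq′ ← ∷-injective
      (encode-injective (q ∷ flatten es) (q′ ∷ flatten es′) (toℕ-injective eq)) =
    refl , flatten-injective es es′ eq′

-- Saturating a finite graph

Lowered : ∀ {ℓ} {C : Set ℓ} (G : Graph C) → Pred (Vertex G) ℓ → Vertex G →
  Vertex G → C → Vertex G → Set ℓ
Lowered G X x v c u = Edge G v c u ⊎ u ≡ x × ∃ λ v′ → X v′ × Edge G v c v′

lower : ∀ {ℓ} {C : Set ℓ} (G : Graph C) → Pred (Vertex G) ℓ → Vertex G → Graph C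
lower G X x = record
  { Vertex = Vertex G
  ; Edge   = Lowered G X x
  ; total  = λ v → let c , v′ , e = total G v in c , v′ , inj₁ e
  }

-- After every move of Adam in G, Eve answers by an ε-move. Vertices inj₂ (just v) leave her
-- no choice; in inj₂ nothing, which Adam may enter instead of any vertex of X, she
-- picks the vertex of X to continue from. A positional strategy picks once and for all.

module _ {ℓ} {C : Set ℓ} (W : Objective C) (prefix : PrefixIndependent W)
  (ε : C) (neutral : WeaklyNeutral W ε) (finitely-positional : PositionalOverFiniteArenas W)
  (G : Graph C) (vs : List (Vertex G)) (∈vs : ∀ v → v ∈ vs)
  (cs : List C) (∈cs : ∀ {v c v′} → Edge G v c v′ → c ∈ cs)
  (sat : G Satisfies W) (X : Pred (Vertex G) ℓ) (inhabited : ∃ X) where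

  private

    V = Vertex G

    data Move : V ⊎ Maybe V → C → V ⊎ Maybe V → Set ℓ where
      direct : ∀ {v c v′} → Edge G v c v′ → Move (inj₁ v) c (inj₂ (just v′))
      offer  : ∀ {v c v′} → X v′ → Edge G v c v′ → Move (inj₁ v) c (inj₂ nothing)
      return : ∀ {v} → Move (inj₂ (just v)) ε (inj₁ v)
      choose : ∀ {x} → X x → Move (inj₂ nothing) ε (inj₁ x)

    arena : Arena C
    arena = record
      { graph = record
        { Vertex = V ⊎ Maybe V
        ; Edge   = Move
        ; total  = λ { (inj₁ v)        → let c , v′ , e = total G v in c , inj₂ (just v′) , direct e
                     ; (inj₂ (just v)) → ε , inj₁ v , return
                     ; (inj₂ nothing)  → ε , inj₁ (proj₁ inhabited) , choose (proj₂ inhabited) }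
        }
      ; owner = λ { (inj₁ _) → adam ; (inj₂ _) → eve }
      }

    arena-vertices : List (V ⊎ Maybe V)
    arena-vertices = map inj₁ vs ++ map inj₂ (nothing ∷ map just vs)

    ∈arena-vertices : ∀ v → v ∈ arena-vertices
    ∈arena-vertices (inj₁ v)        = ∈-++⁺ˡ (∈-map⁺ inj₁ (∈vs v))
    ∈arena-vertices (inj₂ nothing)  = ∈-++⁺ʳ (map inj₁ vs) (here refl)
    ∈arena-vertices (inj₂ (just v)) = ∈-++⁺ʳ (map inj₁ vs) (there (∈-map⁺ inj₂ (∈-map⁺ just (∈vs v))))

    ∈arena-letters : ∀ {v c v′} → Move v c v′ → c ∈ ε ∷ cs
    ∈arena-letters (direct e)  = there (∈cs e)
    ∈arena-letters (offer _ e) = there (∈cs e)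
    ∈arena-letters return      = here refl
    ∈arena-letters (choose _)  = here refl

    arena-finite : FiniteArena arena
    arena-finite = (arena-vertices , ∈arena-vertices) ,
      cartesianProduct arena-vertices (cartesianProduct (ε ∷ cs) arena-vertices) ,
      λ v c v′ m → ∈-cartesianProduct⁺ (∈arena-vertices v)
        (∈-cartesianProduct⁺ (∈arena-letters m) (∈arena-vertices v′))

    -- Eve's winning strategy remembers the vertex that Adam would have gone to.

    data Memory : Set ℓ where
      at within : V → Memory
      below     : ∀ v → X v → Memory

    data Reply : Memory → C → Memory → Set ℓ where
      direct  : ∀ {v c v′} → Edge G v c v′ → Reply (at v) c (within v′)
      offer   : ∀ {v c v′} x → Edge G v c v′ → Reply (at v) c (below v′ x)
      return  : ∀ {v} → Reply (within v) ε (at v)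
      return′ : ∀ {v x} → Reply (below v x) ε (at v)

    strategy : Strategy arena
    strategy = record
      { S = record
        { Vertex = Memory
        ; Edge   = Reply
        ; total  = λ { (at v)      → let c , v′ , e = total G v in c , within v′ , direct e
                     ; (within v)  → ε , at v , return
                     ; (below v x) → ε , at v , return′ }
        }
      ; π = record
        { map      = position
        ; map-edge = λ { (direct e)  → direct e
                       ; (offer x e) → offer x e
                       ; return      → return
                       ; (return′ {x = x}) → choose x }
        }
      ; surjective = λ { (inj₁ v)        → at v , λ { refl → refl }
                       ; (inj₂ (just v)) → within v , λ { refl → refl }
                       ; (inj₂ nothing)  → below (proj₁ inhabited) (proj₂ inhabited) , λ { refl → refl } }
      ; adam-closed = λ { owned (direct e)  (at _) refl → within _ , direct e , refl
                        ; owned (offer x e) (at _) refl → below _ x , offer x e , refl }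
      }
      where
      position : Memory → V ⊎ Maybe V
      position (at v)      = inj₁ v
      position (within v)  = inj₂ (just v)
      position (below v x) = inj₂ nothing

    module _ (w : Word C) (ρ : ℕ → Memory) (path : ∀ i → Reply (ρ i) (w i) (ρ (suc i))) where

      two-steps : ∀ i {v} → ρ i ≡ at v →
        ∃ λ v′ → ρ (2 + i) ≡ at v′ × Edge G v (w i) v′ × w (suc i) ≡ ε
      two-steps i eq with ρ i | w i | ρ (suc i) | w (suc i) | ρ (2 + i) | path i | path (suc i)
      two-steps i refl | _ | _ | _ | _ | _ | direct e  | return  = _ , refl , e , refl
      two-steps i refl | _ | _ | _ | _ | _ | offer _ e | return′ = _ , refl , e , refl

      evens : ∀ {v} → ρ 0 ≡ at v → ∀ k → ∃ λ v → ρ (k * 2) ≡ at v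
      evens eq zero    = _ , eq
      evens eq (suc k) = let _ , eq′ = evens eq k
                             v′ , eq″ , _ = two-steps (k * 2) eq′
                         in v′ , eq″

      -- From `at v` on, moves of `G` alternate with `ε`-replies, so the even positions carry the
      -- label of a path of `G`.
      wins-from-at : ∀ {v} → ρ 0 ≡ at v → w ∈ᵂ W
      wins-from-at eq = Objective.resp W
        (interleave-even-odd w ε λ k → proj₂ (proj₂ (proj₂ (two k))))
        (Equivalence.to (interleave-neutral W prefix neutral (λ k → w (k * 2)))
          (sat _ ((λ k → proj₁ (evens eq k)) , λ k → proj₁ (proj₂ (proj₂ (two k))))))
        where
        two = λ k → two-steps (k * 2) (proj₂ (evens eq k))

    soon-at : ∀ {m c m′} → Reply m c m′ → ∃ (λ v → m ≡ at v) ⊎ ∃ λ v → m′ ≡ at v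
    soon-at (direct _)  = inj₁ (_ , refl)
    soon-at (offer _ _) = inj₁ (_ , refl)
    soon-at return      = inj₂ (_ , refl)
    soon-at return′     = inj₂ (_ , refl)

    strategy-wins : W WinsWith strategy
    strategy-wins w (ρ , path) with soon-at (path 0)
    ... | inj₁ (_ , eq) = wins-from-at w ρ path eq
    ... | inj₂ (_ , eq) = drop-∈ W prefix 1 w
      (wins-from-at (λ k → w (k + 1)) (λ k → ρ (k + 1)) (λ k → path (k + 1)) eq)

  -- A positional strategy is a subgraph on all vertices of the arena. It keeps Adam's edges, every
  -- `return` (the only exit there), and at `nothing` an edge to some `x` in `X`. Each edge of
  -- `lower G X x` is thus simulated by two kept steps, the second labelled `ε`.
  lower-satisfies : ∃ λ x → X x × lower G X x Satisfies W
  lower-satisfies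
    with σ , injective , wins ← finitely-positional arena arena-finite (strategy , strategy-wins)
    = answer
    where
    open Strategy σ using (S; surjective; adam-closed; map-edge) renaming (map to position)

    over : V ⊎ Maybe V → Vertex S
    over v = proj₁ (surjective v)

    position-over : ∀ v → position (over v) ≡ v
    position-over v = proj₂ (surjective v) refl

    Kept : V ⊎ Maybe V → C → V ⊎ Maybe V → Set ℓ
    Kept u c v = Edge S (over u) c (over v)

    kept : ∀ {u c s v} → Edge S (over u) c s → position s ≡ v → Kept u c v
    kept {v = v} e eq = subst (Edge S _ _) (injective (trans eq (sym (position-over v)))) e

    adam-kept : ∀ {v c u} → Move (inj₁ v) c u → Kept (inj₁ v) c u
    adam-kept m = let s , e , eq = adam-closed refl m _ (position-over _) in kept e eq

    eve-moves : ∀ v → ∃₂ λ c u → Move (inj₂ v) c u × Kept (inj₂ v) c u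
    eve-moves v =
      let c , s , e = total S (over (inj₂ v))
      in c , position s , subst (λ u → Move u c (position s)) (position-over _) (map-edge e) , kept e refl

    return-kept : ∀ v → Kept (inj₂ (just v)) ε (inj₁ v)
    return-kept v with eve-moves (just v)
    ... | _ , _ , return , k = k

    answer : ∃ λ x → X x × lower G X x Satisfies W
    answer with eve-moves nothing
    ... | _ , inj₁ x , choose Xx , k = x , Xx , satisfies
      where
      via : ∀ {v c u} → Lowered G X x v c u →
        ∃ λ m → Kept (inj₁ v) c (inj₂ m) × Kept (inj₂ m) ε (inj₁ u)
      via {u = u} (inj₁ e)            = just u , adam-kept (direct e) , return-kept u
      via (inj₂ (refl , v′ , Xv′ , e)) = nothing , adam-kept (offer Xv′ e) , k

      satisfies : lower G X x Satisfies W
      satisfies w (ρ , path) = Equivalence.from (interleave-neutral W prefix neutral w)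
        (wins _ (_ , kept-path))
        where
        steps = λ i → via (path i)

        kept-path = interleave-step (Edge S)
          (λ i → over (inj₁ (ρ i))) (λ i → over (inj₂ (proj₁ (steps i)))) w (const ε)
          (λ i → proj₁ (proj₂ (steps i))) (λ i → proj₂ (proj₂ (steps i)))

-- Minima and stabilisation

module _ (em : ∀ {a} → ExcludedMiddle a) where

  stable : ∀ {a} {P : Set a} → ¬ ¬ P → P
  stable = decidable-stable em

  minimum : ∀ {a r p} {A : Set a} {_≺_ : Rel A r} → WellFounded _≺_ →
    (P : Pred A p) → ∃ P → ∃ λ x → P x × ∀ y → P y → ¬ (y ≺ x)
  minimum {_≺_ = _≺_} wf P (x , Px) = go x (wf x) Px
    where
    go : ∀ x → Acc _≺_ x → P x → ∃ λ x → P x × ∀ y → P y → ¬ (y ≺ x)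
    go x (acc rs) Px with em {P = ∃ λ y → P y × y ≺ x}
    ... | yes (y , Py , y≺x) = go y (rs y≺x) Py
    ... | no ¬smaller        = x , Px , λ y Py y≺x → ¬smaller (y , Py , y≺x)

  maximum : ∀ {p} (P : Pred ℕ p) N → (∀ q → P q → q ≤ N) → ∃ P →
    ∃ λ m → P m × ∀ q → P q → q ≤ m
  maximum P zero    bound (q , Pq) = q , Pq , λ q′ Pq′ → ≤-trans (bound q′ Pq′) z≤n
  maximum P (suc N) bound ∃P with em {P = P (suc N)}
  ... | yes PN = suc N , PN , bound
  ... | no ¬PN = maximum P N (λ q Pq → s≤s⁻¹ (≤∧≢⇒< (bound q Pq) λ { refl → ¬PN Pq })) ∃P

  -- If some `f i` is below no `g j`, then by induction every `g j` is strictly below `f i`, whence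
  -- `sup g ≤ᵒ f i`.
  ≤ᵒ-or-> : ∀ {ℓ} (α β : Ord ℓ) → α ≤ᵒ β ⊎ β <ᵒ α
  ≤ᵒ-or-> (sup f) (sup g) with em {P = sup f ≤ᵒ sup g}
  ... | yes f≤g = inj₁ f≤g
  ... | no ¬f≤g = inj₂ (i , bounded (f i) above)
    where
    counterexample : ∃ λ i → ¬ ∃ λ j → f i ≤ᵒ g j
    counterexample = stable λ h → ¬f≤g λ i → stable λ ¬j → h (i , ¬j)

    i = proj₁ counterexample

    above : ∀ j → g j <ᵒ f i
    above j with ≤ᵒ-or-> (f i) (g j)
    ... | inj₁ fi≤gj = ⊥-elim (proj₂ counterexample (j , fi≤gj))
    ... | inj₂ gj<fi = gj<fi

    bounded : ∀ α → (∀ j → g j <ᵒ α) → sup g ≤ᵒ α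
    bounded (sup h) g<h = g<h

  ≮⇒≤ᵒ : ∀ {ℓ} (α β : Ord ℓ) → ¬ (β <ᵒ α) → α ≤ᵒ β
  ≮⇒≤ᵒ α β β≮α with ≤ᵒ-or-> α β
  ... | inj₁ α≤β = α≤β
  ... | inj₂ β<α = ⊥-elim (β≮α β<α)

  -- Beyond an index where the value is minimal, a decreasing sequence stays equivalent to it.
  -- Antisymmetry is not assumed, so that ordinals are covered.
  stabilises : ∀ {a r s} {A : Set a} {_≼_ : Rel A r} {_≺_ : Rel A s} →
    WellFounded _≺_ → (∀ x y → ¬ (y ≺ x) → x ≼ y) → Transitive _≼_ →
    ∀ (x : ℕ → A) → (∀ k → x (suc k) ≼ x k) →
    ∃ λ n → ∀ k → x (k + n) ≼ x (suc (k + n))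
  stabilises {_≼_ = _≼_} {_≺_} wf ≮⇒≼ ≼-trans x decreasing =
    n , λ k → ≼-trans (below-n k) (above (suc (k + n)))
    where
    minimal = minimum wf (λ y → ∃ λ m → y ≡ x m) (x 0 , 0 , refl)
    n = proj₁ (proj₁ (proj₂ minimal))

    above : ∀ m → x n ≼ x m
    above m rewrite sym (proj₂ (proj₁ (proj₂ minimal))) =
      ≮⇒≼ _ _ (proj₂ (proj₂ minimal) (x m) (m , refl))

    below-n : ∀ k → x (k + n) ≼ x n
    below-n zero    = above n
    below-n (suc k) = ≼-trans (decreasing (k + n)) (below-n k)

  -- Enumeration of sound edge lists and the category argument

  module _ {ℓ} {C : Set ℓ} (C↣ℕ : C ↣ ℕ) (W : Objective C) where

    -- Excluded middle inverts `pair-code`, which enumerates all pairs of a state and a sound list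
    -- for the diagonal path to defeat.
    pairs : ∀ t → ∃₂ λ q es → Sound W es × (∀ q′ es′ → Sound W es′ →
      pair-code C↣ℕ q′ es′ ≡ t → q′ ≡ q × es′ ≡ es)
    pairs t with em {P = ∃₂ λ q es → Sound W es × pair-code C↣ℕ q es ≡ t}
    ... | yes (q , es , sound , eq) = q , es , sound , λ q′ es′ _ eq′ →
      pair-code-injective C↣ℕ q′ q es′ es (trans eq′ (sym eq))
    -- A number coding no sound pair yields the empty list, sound because it has no run.
    ... | no none = 0 , [] , (λ w ρ run → ⊥-elim (no-step (run 0))) , λ q es sound eq →
      ⊥-elim (none (q , es , sound , eq))
      where
      no-step : ∀ {q c q′} → ¬ Step {C = C} [] q c q′
      no-step (_ , _ , () , _)

    start : ℕ → ℕ
    start t = proj₁ (pairs t)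

    reader : ℕ → EdgeList C
    reader t = proj₁ (proj₂ (pairs t))

    -- Baire category: a path defeating every sound edge list in turn has its label
    -- outside the monotone core.

    module _ (G : Graph C) (X : Pred (Vertex G) ℓ)
      (escape : ∀ v → ¬ X v → ∀ es → Sound W es → ∀ q → Bad G X es v q)
      (v₀ : Vertex G) (v₀∉X : ¬ X v₀) where

      -- `bad` is what remains of the witness against pair number `phase`. Each move consumes one
      -- edge of it; its final `stuck` edge leads into the next phase.
      record State : Set ℓ where
        constructor ⟨_,_⟩
        field
          phase  : ℕ
          {vertex} : Vertex G
          {reads} : ℕ
          bad    : Bad G X (reader phase) vertex reads

      open State

      begin : ∀ t v → ¬ X v → State
      begin t v v∉X = ⟨ t , escape v v∉X (reader t) (proj₁ (proj₂ (proj₂ (pairs t)))) (start t) ⟩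

      next : State → State
      next ⟨ t , stuck {v′ = v′} _ v′∉X _ ⟩ = begin (suc t) v′ v′∉X
      next ⟨ t , step _ _ _ bad ⟩           = ⟨ t , bad ⟩

      letter : State → C
      letter ⟨ _ , stuck {c = c} _ _ _ ⟩  = c
      letter ⟨ _ , step {c = c} _ _ _ _ ⟩ = c

      next-edge : ∀ s → Edge G (vertex s) (letter s) (vertex (next s))
      next-edge ⟨ _ , stuck e _ _ ⟩  = e
      next-edge ⟨ _ , step e _ _ _ ⟩ = e

      play : ℕ → State
      play zero    = begin 0 v₀ v₀∉X
      play (suc i) = next (play i)

      diagonal : Word C
      diagonal = letter ∘ play

      phase-ends : ∀ {t v q} (bad : Bad G X (reader t) v q) i → play i ≡ ⟨ t , bad ⟩ →
        ∃ λ j → i < j × ∃₂ λ v′ v′∉X → play j ≡ begin (suc t) v′ v′∉X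
      phase-ends (stuck _ v′∉X _) i eq = suc i , ≤-refl , _ , v′∉X , cong next eq
      phase-ends (step _ _ _ bad) i eq =
        let j , i<j , rest = phase-ends bad (suc i) (cong next eq) in
        j , <-trans ≤-refl i<j , rest

      phase-starts : ∀ t → ∃ λ j → t ≤ j × ∃₂ λ v v∉X → play j ≡ begin t v v∉X
      phase-starts zero    = 0 , z≤n , v₀ , v₀∉X , refl
      phase-starts (suc t) with phase-starts t
      ... | j , t≤j , v , v∉X , eq =
        let j′ , j<j′ , rest = phase-ends _ j eq in j′ , ≤-trans (s≤s t≤j) j<j′ , rest

      -- By monotonicity and greediness, the states of the witness dominate those of any run
      -- starting below them, so no run gets past the `stuck` letter.
      unreadable : ∀ {t v q} n ρ → Run (reader t) (λ k → diagonal (k + n)) ρ →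
        (bad : Bad G X (reader t) v q) → ∀ k → play (k + n) ≡ ⟨ t , bad ⟩ → ρ k ≤ q → ⊥
      unreadable n ρ run bad k eq ρk≤q with Step-mono ρk≤q ≤-refl (run k)
      unreadable n ρ run (stuck _ _ none) k eq ρk≤q | s rewrite eq = none _ s
      unreadable {t} n ρ run (step {q = q} {c} _ _ greedy bad) k eq ρk≤q | s =
        unreadable n ρ run bad (suc k) (cong next eq)
          (greedy _ (subst (λ d → Step (reader t) q d (ρ (suc k))) (cong letter eq) s))

      diagonal∉ : ¬ (diagonal ∈ᵂ MonotoneCore W)
      diagonal∉ (es , sound , n , ρ , run) =
        unreadable n ρ (subst (λ es → Run es _ ρ) es≡reader run) _ (suc k)
          (trans (cong play j≡k+n) eq)
          (subst (ρ (suc k) ≤_) q≡start (≤-trans (Step-bound es (run k)) (m≤m+n _ n)))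
        where
        -- q bounds ρ beyond its first value, and since the code of a list exceeds its
        -- head, phase t starts after position n.
        q t j k : ℕ
        q = target-bound es + n
        t = pair-code C↣ℕ q es

        start-reader : q ≡ start t × es ≡ reader t
        start-reader = proj₂ (proj₂ (proj₂ (pairs t))) q es sound refl

        q≡start   = proj₁ start-reader
        es≡reader = proj₂ start-reader

        started = phase-starts t
        j       = proj₁ started
        eq      = proj₂ (proj₂ (proj₂ (proj₂ started)))

        n<j : n < j
        n<j = <-≤-trans (≤-<-trans (m≤n+m n _) (head<encode q _)) (proj₁ (proj₂ started))

        k = j ∸ suc n

        j≡k+n : suc k + n ≡ j
        j≡k+n = trans (sym (+-suc k n)) (m∸n+n≡m n<j)

      escape-contradiction : ¬ (G Satisfies MonotoneCore W)
      escape-contradiction sat = diagonal∉ (sat diagonal (vertex ∘ play , next-edge ∘ play))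

    -- The removal closes off at `sup rank`, a stage beyond one chosen stage for each readable
    -- vertex. A vertex left outside `X` is bad for every sound list, since otherwise it would be
    -- readable at stage `sup rank` and so already in `X`; the category argument then applies to
    -- what is left.
    every-vertex-readable : (G : Graph C) → G Satisfies MonotoneCore W →
      ∀ v → ∃ λ α → Readable W G (Below W G α) v
    every-vertex-readable G sat v = stable λ ¬readable →
      escape-contradiction G X escape v (¬readable ∘ readable) sat
      where
      rank : Vertex G → Ord ℓ
      rank u with em {P = ∃ λ α → Readable W G (Below W G α) u}
      ... | yes (α , _) = α
      ... | no _        = sup {I = Lift ℓ ⊥} λ ()

      X : Pred (Vertex G) ℓ
      X = Below W G (sup rank)

      readable : ∀ {u} → X u → ∃ λ α → Readable W G (Below W G α) u
      readable (u′ , r) = rank u′ , r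

      ranked : ∀ u → (∃ λ α → Readable W G (Below W G α) u) → X u
      ranked u ∃α = u , readable-at-rank
        where
        readable-at-rank : Readable W G (Below W G (rank u)) u
        readable-at-rank with em {P = ∃ λ α → Readable W G (Below W G α) u}
        ... | yes (_ , r) = r
        ... | no ¬∃α      = ⊥-elim (¬∃α ∃α)

      escape : ∀ u → ¬ X u → ∀ es → Sound W es → ∀ q → Bad G X es u q
      escape u u∉X es sound q = stable λ ¬bad →
        u∉X (ranked u (sup rank , es , sound , q , ¬bad))

    -- Outside `X`, the letter must be readable and its largest target must again be good: a failure
    -- of either would be a `stuck` or a `step` witness.
    ¬Bad-step : ∀ {G : Graph C} {X es v q c v′} → ¬ Bad G X es v q → Edge G v c v′ →
      X v′ ⊎ ∃ λ q′ → Step es q c q′ × ¬ Bad G X es v′ q′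
    ¬Bad-step {X = X} {es} {q = q} {c} {v′} ¬bad e with em {P = X v′} | em {P = ∃ (Step es q c)}
    ... | yes v′∈X | _       = inj₁ v′∈X
    ... | no v′∉X  | no none = ⊥-elim (¬bad (stuck e v′∉X λ q′ s → none (q′ , s)))
    ... | no v′∉X  | yes ∃q′ =
      let q′ , s , greedy = maximum (Step es q c) (target-bound es) (λ _ → Step-bound es) ∃q′
      in inj₂ (q′ , s , ¬bad ∘ step e v′∉X greedy)

    -- Lexicographic ranks

    record Key : Set (lsuc ℓ) where
      constructor key
      field
        ordinal : Ord ℓ
        edges   : EdgeList C
        state   : ℕ

      index : ℕ
      index = code C↣ℕ edges

    open Key

    _≼_ : Rel Key ℓ
    k ≼ k′ = ordinal k ≤ᵒ ordinal k′ ×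
      (ordinal k′ ≤ᵒ ordinal k → index k ≤ index k′ ×
        (index k ≡ index k′ → state k ≤ state k′))

    -- The components are minimised in turn. `R-mono` transports a competitor whose ordinal is only
    -- equivalent to `α₀` to `α₀` itself.
    least : (R : Pred Key ℓ) →
      (∀ {α β es q} → α ≤ᵒ β → R (key α es q) → R (key β es q)) →
      ∃ R → ∃ λ k → R k × ∀ k′ → R k′ → k ≼ k′
    least R R-mono (key α es q , Rk)
      with α₀ , (_ , _ , R₀) , α₀-min ←
        minimum <ᵒ-wellFounded (λ α → ∃₂ λ es q → R (key α es q)) (α , es , q , Rk)
      with _ , (es₁ , _ , R₁ , refl) , i-min ←
        minimum <-wellFounded (λ i → ∃₂ λ es q → R (key α₀ es q) × i ≡ code C↣ℕ es) (_ , _ , _ , R₀ , refl)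
      with q₂ , R₂ , q₂-min ← minimum <-wellFounded (λ q → R (key α₀ es₁ q)) (_ , R₁)
      = key α₀ es₁ q₂ , R₂ , λ { (key α es q) Rk →
          ≮⇒≤ᵒ α₀ α (α₀-min α (es , q , Rk)) , λ α≤α₀ →
          ≮⇒≥ (i-min _ (es , q , R-mono α≤α₀ Rk , refl)) , λ eq →
          ≮⇒≥ (q₂-min q (subst (λ es → R (key α₀ es q))
            (sym (code-injective C↣ℕ es₁ es eq)) (R-mono α≤α₀ Rk))) }

    Descends : Key → C → Key → Set ℓ
    Descends k c k′ = ordinal k′ ≤ᵒ ordinal k ×
      (ordinal k ≤ᵒ ordinal k′ → index k′ ≤ index k ×
        (index k ≡ index k′ → Step (edges k) (state k) c (state k′)))

    -- First the ordinal stabilises, then the index; as codes are injective the edge list is then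
    -- fixed, and the states form a run of it on a suffix.
    Descends-∈ : (κ : ℕ → Key) → (∀ i → Sound W (edges (κ i))) → (w : Word C) →
      (∀ i → Descends (κ i) (w i) (κ (suc i))) → w ∈ᵂ MonotoneCore W
    Descends-∈ κ sound w descends
      with n , const-ordinal ← stabilises <ᵒ-wellFounded ≮⇒≤ᵒ ≤ᵒ-trans (ordinal ∘ κ) (proj₁ ∘ descends)
      = drop-∈ (MonotoneCore W) (MonotoneCore-prefixIndependent W) n w
          (fixed-ordinal (λ k → κ (k + n)) (λ k → sound (k + n)) (λ k → w (k + n))
            (λ k → proj₂ (descends (k + n)) (const-ordinal k)))
      where
      fixed-ordinal : (κ : ℕ → Key) → (∀ i → Sound W (edges (κ i))) → (w : Word C) →
        (∀ i → index (κ (suc i)) ≤ index (κ i) × (index (κ i) ≡ index (κ (suc i)) →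
          Step (edges (κ i)) (state (κ i)) (w i) (state (κ (suc i))))) →
        w ∈ᵂ MonotoneCore W
      fixed-ordinal κ sound w descends
        with m , const-index ← stabilises <-wellFounded (λ _ _ → ≮⇒≥) ≤-trans (index ∘ κ) (proj₁ ∘ descends)
        = edges (κ m) , sound m , m , (λ k → state (κ (k + m))) , run
        where
        index≡ : ∀ k → index (κ (k + m)) ≡ index (κ (suc (k + m)))
        index≡ k = ≤-antisym (const-index k) (proj₁ (descends (k + m)))

        edges≡ : ∀ k → edges (κ (k + m)) ≡ edges (κ m)
        edges≡ zero    = refl
        edges≡ (suc k) = trans (sym (code-injective C↣ℕ _ _ (index≡ k))) (edges≡ k)

        run : Run (edges (κ m)) (λ k → w (k + m)) (λ k → state (κ (k + m)))
        run k = subst (λ es → Step es (state (κ (k + m))) (w (k + m)) (state (κ (suc k + m))))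
          (edges≡ k) (proj₂ (descends (k + m)) (index≡ k))

    -- Positionality over arbitrary arenas

    MonotoneCore-positional : PositionalOverArbitraryArenas (MonotoneCore W)
    MonotoneCore-positional A (σ , sat) = τ , id , wins
      where
      open Strategy σ using (S; surjective; adam-closed) renaming (map to proj; map-edge to proj-edge)

      Rank : Vertex S → Pred Key ℓ
      Rank s (key α es q) = Sound W es × ¬ Bad S (Below W S α) es s q

      FibreRank : Vertex (graph A) → Pred Key ℓ
      FibreRank v k = ∃ λ s → proj s ≡ v × Rank s k

      FibreRank-mono : ∀ {v α β es q} → α ≤ᵒ β →
        FibreRank v (key α es q) → FibreRank v (key β es q)
      FibreRank-mono {α = α} {β} α≤β (s , eq , sound , ¬bad) =
        s , eq , sound , ¬bad ∘ Bad-antitone W S (Below-mono W S α β α≤β)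

      fibre-ranked : ∀ v → ∃ (FibreRank v)
      fibre-ranked v =
        let s , eq = surjective v
            α , es , sound , q , ¬bad = every-vertex-readable S sat s
        in key α es q , s , eq refl , sound , ¬bad

      abstract
        best : ∀ v → ∃ λ k → FibreRank v k × ∀ k′ → FibreRank v k′ → k ≼ k′
        best v = least (FibreRank v) FibreRank-mono (fibre-ranked v)

      κ : Vertex (graph A) → Key
      κ v = proj₁ (best v)

      lift-vertex : Vertex (graph A) → Vertex S
      lift-vertex v = proj₁ (proj₁ (proj₂ (best v)))

      proj-lift : ∀ v → proj (lift-vertex v) ≡ v
      proj-lift v = proj₁ (proj₂ (proj₁ (proj₂ (best v))))

      rank-lift : ∀ v → Rank (lift-vertex v) (κ v)
      rank-lift v = proj₂ (proj₂ (proj₁ (proj₂ (best v))))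

      -- From `v`, Eve plays as at its representative; on reaching `s′` she continues from the
      -- representative of the fibre of `s′`.
      T : Graph C
      T = record
        { Vertex = Vertex (graph A)
        ; Edge   = λ v c v′ → ∃ λ s′ → Edge S (lift-vertex v) c s′ × proj s′ ≡ v′
        ; total  = λ v → let c , s′ , e = total S (lift-vertex v) in c , proj s′ , s′ , e , refl
        }

      τ : Strategy A
      τ = record
        { S           = T
        ; π           = record
          { map      = id
          ; map-edge = λ { {v} (s′ , e , refl) → subst (λ u → Edge (graph A) u _ _) (proj-lift v) (proj-edge e) }
          }
        ; surjective  = λ v → v , id
        ; adam-closed = λ { {v′ = v′} owned e v refl →
            v′ , adam-closed owned e (lift-vertex v) (proj-lift v) , refl }
        }

      -- The endpoint `s′` has either a rank of smaller ordinal, or one with the ordinal and list of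
      -- `κ v` and a state reached by reading `c`. As `s′` lies over `v′`, minimality puts `κ v′`
      -- below that rank.
      descends : ∀ {v c v′} → Edge T v c v′ → Descends (κ v) c (κ v′)
      descends {v} {c} {v′} (s′ , e , eq) with ¬Bad-step (proj₂ (rank-lift v)) e
      ... | inj₁ below =
        <ᵒ⇒≤ᵒ (ordinal (κ v′)) (ordinal (κ v)) v′<v , λ v≤v′ → ⊥-elim (≤ᵒ⇒≯ᵒ _ _ v≤v′ v′<v)
        where
        smaller : ∀ α → Below W S α s′ → ordinal (κ v′) <ᵒ α
        smaller (sup f) (i , es , sound , q , ¬bad) =
          i , proj₁ (proj₂ (proj₂ (best v′)) (key (f i) es q) (s′ , eq , sound , ¬bad))

        v′<v = smaller (ordinal (κ v)) below
      ... | inj₂ (q′ , s , ¬bad)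
        with ≤α , rest ← proj₂ (proj₂ (best v′)) (key (ordinal (κ v)) (edges (κ v)) q′)
                           (s′ , eq , proj₁ (rank-lift v) , ¬bad) =
        ≤α , λ α≤ → let ≤i , ≤q = rest α≤ in
        ≤i , λ i≡ → Step-mono ≤-refl (≤q (sym i≡)) s

      wins : T Satisfies MonotoneCore W
      wins w (ρ , path) = Descends-∈ (κ ∘ ρ) (proj₁ ∘ rank-lift ∘ ρ) w (descends ∘ path)

  -- Linear orders on finite graphs

  record Saturation {ℓ} {C : Set ℓ} (W : Objective C) (G : Graph C) (X : Pred (Vertex G) ℓ) :
      Set (lsuc ℓ) where
    field
      Edge⁺     : Vertex G → C → Vertex G → Set ℓ
      rank      : Vertex G → ℕ
      extends   : ∀ {v c u} → Edge G v c u → Edge⁺ v c u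
      -- Added edges merely redirect original ones within `X`. This lets them be lowered to `x` in
      -- the induction, and brings in no new letters.
      origin    : ∀ {v c u} → Edge⁺ v c u →
                  Edge G v c u ⊎ X u × ∃ λ v′ → X v′ × Edge G v c v′
      closed    : ∀ {v c u y} → X u → X y → rank y ≤ rank u → Edge⁺ v c u → Edge⁺ v c y
      satisfies : ∀ w (ρ : ℕ → Vertex G) → (∀ i → Edge⁺ (ρ i) (w i) (ρ (suc i))) → w ∈ᵂ W

  module _ {ℓ} {C : Set ℓ} (W : Objective C) (prefix : PrefixIndependent W)
    (ε : C) (neutral : WeaklyNeutral W ε) (finitely-positional : PositionalOverFiniteArenas W) where

    -- The `x` found by `lower-satisfies` gets rank 0; the rest of `X` is ordered above it by
    -- saturating `lower G X x`. The bound `n` decreases because filtering removes `x` from `xs`.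
    saturate : ∀ n (G : Graph C) (vs : List (Vertex G)) → (∀ v → v ∈ vs) →
      (cs : List C) → (∀ {v c v′} → Edge G v c v′ → c ∈ cs) → G Satisfies W →
      (X : Pred (Vertex G) ℓ) (xs : List (Vertex G)) → X ⊆ (_∈ xs) → length xs < n →
      Saturation W G X
    saturate (suc n) G vs ∈vs cs ∈cs sat X xs X⊆xs (s≤s xs≤n) with em {P = ∃ X}
    ... | no empty = record
      { Edge⁺     = Edge G
      ; rank      = const 0
      ; extends   = id
      ; origin    = inj₁
      ; closed    = λ {_} {_} {u} Xu → ⊥-elim (empty (u , Xu))
      ; satisfies = λ w ρ path → sat w (ρ , path)
      }
    ... | yes inhabited
      with x , Xx , sat-lower ← lower-satisfies W prefix ε neutral finitely-positional G vs ∈vs cs ∈cs sat X inhabited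
      = record
      { Edge⁺     = Edge⁺
      ; rank      = rank⁺
      ; extends   = extends ∘ inj₁
      ; origin    = origin⁺ ∘ origin
      ; closed    = closed⁺
      ; satisfies = satisfies
      }
      where
      rest : Pred (Vertex G) ℓ
      rest v = X v × v ≢ x

      ≢x? : ∀ v → Dec (v ≢ x)
      ≢x? v = em

      saturated : Saturation W (lower G X x) rest
      saturated = saturate n (lower G X x) vs ∈vs cs
        (λ { (inj₁ e) → ∈cs e ; (inj₂ (_ , _ , _ , e)) → ∈cs e }) sat-lower
        rest (filter ≢x? xs) (λ (Xv , v≢x) → ∈-filter⁺ ≢x? (X⊆xs Xv) v≢x)
        (<-≤-trans (filter-notAll ≢x? xs (Any.map (λ x≡v v≢x → v≢x (sym x≡v)) (X⊆xs Xx))) xs≤n)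

      open Saturation saturated

      origin⁺ : ∀ {v c u} →
        Lowered G X x v c u ⊎ rest u × ∃ (λ v′ → rest v′ × Lowered G X x v c v′) →
        Edge G v c u ⊎ X u × ∃ λ v′ → X v′ × Edge G v c v′
      origin⁺ (inj₁ (inj₁ e))                                 = inj₁ e
      origin⁺ (inj₁ (inj₂ (refl , e)))                        = inj₂ (Xx , e)
      origin⁺ (inj₂ ((Xu , _) , v′ , (Xv′ , _) , inj₁ e))     = inj₂ (Xu , v′ , Xv′ , e)
      origin⁺ (inj₂ ((Xu , _) , _ , _ , inj₂ (_ , e)))        = inj₂ (Xu , e)

      -- The original edge behind `e` ends in `X`, so `lower` has already added `x` beside its
      -- target.
      lowest : ∀ {v c u} → X u → Edge⁺ v c u → Edge⁺ v c x
      lowest Xu e with origin⁺ (origin e)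
      ... | inj₁ e′       = extends (inj₂ (refl , _ , Xu , e′))
      ... | inj₂ (_ , e′) = extends (inj₂ (refl , e′))

      rank⁺ : Vertex G → ℕ
      rank⁺ v with em {P = v ≡ x}
      ... | yes _ = 0
      ... | no _  = suc (rank v)

      closed⁺ : ∀ {v c u y} → X u → X y → rank⁺ y ≤ rank⁺ u → Edge⁺ v c u → Edge⁺ v c y
      -- The case `y ≢ x`, `u ≡ x` cannot occur, as only `x` has rank 0.
      closed⁺ {u = u} {y} Xu Xy y≤u e with em {P = y ≡ x} | em {P = u ≡ x}
      ... | yes refl | _      = lowest Xu e
      ... | no y≢x   | no u≢x = closed (Xu , u≢x) (Xy , y≢x) (s≤s⁻¹ y≤u) e

    finite-monotone-core : (G : Graph C) (vs : List (Vertex G)) → (∀ v → v ∈ vs) →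
      (cs : List C) → (∀ {v c v′} → Edge G v c v′ → c ∈ cs) →
      G Satisfies W → G Satisfies MonotoneCore W
    finite-monotone-core G vs ∈vs cs ∈cs sat w (ρ , path) =
      es , sound , 0 , rank ∘ ρ , λ k → subst (λ n → Step es (rank (ρ k)) (w n) (rank (ρ (suc k))))
        (sym (+-identityʳ k)) (_ , _ , listed (extends (path k)) , ≤-refl , ≤-refl)
      where
      saturated : Saturation W G (λ _ → ⊤)
      saturated = saturate (suc (length vs)) G vs ∈vs cs ∈cs sat (λ _ → ⊤) vs (λ _ → ∈vs _) ≤-refl

      open Saturation saturated

      triples = cartesianProduct vs (cartesianProduct cs vs)

      edge? : ∀ ((v , c , u) : Vertex G × C × Vertex G) → Dec (Edge⁺ v c u)
      edge? _ = em

      ranked : Vertex G × C × Vertex G → ℕ × C × ℕ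
      ranked (v , c , u) = rank v , c , rank u

      es : EdgeList C
      es = map ranked (filter edge? triples)

      letter⁺ : ∀ {v c u} → Edge⁺ v c u → c ∈ cs
      letter⁺ e with origin e
      ... | inj₁ e′               = ∈cs e′
      ... | inj₂ (_ , _ , _ , e′) = ∈cs e′

      listed : ∀ {v c u} → Edge⁺ v c u → (rank v , c , rank u) ∈ es
      listed e = ∈-map⁺ ranked (∈-filter⁺ edge?
        (∈-cartesianProduct⁺ (∈vs _) (∈-cartesianProduct⁺ (letter⁺ e) (∈vs _))) e)

      unlist : ∀ {q c q′} → Step es q c q′ → ∃₂ λ v u → Edge⁺ v c u × rank v ≤ q × q′ ≤ rank u
      unlist (_ , _ , ∈es , p≤q , q′≤p′) with ∈-map⁻ ranked ∈es
      ... | (v , _ , u) , ∈edges , refl =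
        v , u , proj₂ (∈-filter⁻ edge? {xs = triples} ∈edges) , p≤q , q′≤p′

      sound : Sound W es
      -- The listed edges behind consecutive steps need not meet, but the next source ranks no
      -- higher than the current target, so `closed` lowers that target onto it.
      sound w ρ run = satisfies w (λ i → proj₁ (edge i)) λ i →
        let _ , _ , e , _ , ≤u = edge i
            _ , _ , _ , v≤ , _ = edge (suc i)
        in closed _ _ (≤-trans v≤ ≤u) e
        where
        edge = λ i → unlist (run i)

    -- Finite equivalence

    MonotoneCore-finitelyEquivalent : FinitelyEquivalent (MonotoneCore W) W
    MonotoneCore-finitelyEquivalent A finite@((vs , ∈vs) , es , ∈es) = mk⇔
      (λ (σ , wins) → σ , λ w → MonotoneCore-⊆ W prefix w ∘ wins w)
      -- A positional strategy embeds in the finite arena, so its graph is finite and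
      -- `finite-monotone-core` applies to it.
      λ win → let σ , injective , wins = finitely-positional A finite win
                  open Strategy σ renaming (map to position)
                  preimage = proj₁ ∘ surjective
              in σ , finite-monotone-core S (map preimage vs)
                   (λ s → subst (_∈ map preimage vs) (injective (proj₂ (surjective (position s)) refl))
                     (∈-map⁺ preimage (∈vs (position s))))
                   (map (proj₁ ∘ proj₂) es)
                   (λ e → ∈-map⁺ (proj₁ ∘ proj₂) (∈es _ _ _ (map-edge e)))
                   wins

theorem1p4 : (∀ {a} → ExcludedMiddle a) →
    ∀ {ℓ} (C : Set ℓ) → C ↣ ℕ →
    (W : Objective C) →
    PrefixIndependent W →
    PositionalOverFiniteArenas W →
    (∃ λ ε → WeaklyNeutral W ε) →
    ∃ λ (W′ : Objective C) →
    PrefixIndependent W′ ×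
    W′ ⊆ᵂ W ×
    FinitelyEquivalent W′ W ×
    PositionalOverArbitraryArenas W′
theorem1p4 em C C↣ℕ W prefix finitely-positional (ε , neutral) =
  MonotoneCore W ,
  MonotoneCore-prefixIndependent W ,
  MonotoneCore-⊆ W prefix ,
  MonotoneCore-finitelyEquivalent em W prefix ε neutral finitely-positional ,
  MonotoneCore-positional em C↣ℕ W
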